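{- Let $H$ be the complement of the cycle on seven vertices, i.e. the graph with vertex set $\mathbb Z_7$ in which $u,v$ are adjacent exactly when their cyclic distance is two or three. Then $$\mathrm{lrw}(H)=2\qquad\text{and}\qquad \mathrm{lsfw}(H)=8 .$$ Consequently, the inequality $\mathrm{lsfw}(G)\le 2\,\mathrm{lrw}(G)+2$ does not hold for all graphs $G$.
   Context: All graphs are finite, simple and undirected. Both parameters are assigned value $0$ on the empty graph. Linear rank-width. For $X\subseteq V(G)$ the cutrank $\rho_G(X)$ is the rank over $\mathbb F_2$ of the $X\times (V(G)\setminus X)$ adjacency matrix. For a linear order $\pi=(v_1,\dots,v_n)$ of $V(G)$ put $P_i=\{v_1,\dots,v_i\}$ for $0\le i\le n$. Then $\mathrm{lrw}(G)=\min_\pi\max_i\rho_G(P_i)$, the minimum over all linear orders $\pi$ of $V(G)$. Sequential cable plays. A configuration on $G$ consists of the set of born vertices, a family $\mathcal L$ of pairwise disjoint nonempty sets of born vertices (the live cables), and a set of already placed edges; initially all are empty. With $\ell=|\mathcal L|$ the number of live cables before a move, the moves are: (i) birth$(S)$: introduces a nonempty set $S$ of fresh (not yet born) vertices of $G$ as one live cable; cost $2\ell+1$. (ii) fold$(X,Y)$: replaces two distinct live cables $X,Y$ by $X\cup Y$; cost $2\ell-1$. (iii) block$(X,Y)$: places every edge between two distinct live cables $X,Y$; legal when all these pairs are edges of $G$ and at least one has not already been placed; cost $2\ell$. (iv) clique$(X)$: places every edge inside a live cable $X$; legal when $X$ is a clique of $G$ and at least one internal edge has not already been placed; cost $2\ell$.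 (v) close$(X)$: removes the live cable $X$; legal when every edge of $G$ incident with a vertex of $X$ has already been placed; cost $2\ell-1$. A play (a finite sequence of legal moves from the initial configuration) constructs $G$ if every vertex is born, every edge of $G$ is placed, and every cable is closed. The width of a play is the maximum cost of its moves, and $\mathrm{lsfw}(G)$ is the minimum width of a play constructing $G$. -}

module Defs where

open import Algebra.Bundles using (CommutativeRing)
open import Data.Bool.Base using (Bool; true; false; not; _∧_; _∨_; T)
open import Data.Bool.Properties using (xor-∧-commutativeRing; T-∨; T-∧; T-≡)
import Data.Bool.Properties as Bool
open import Data.Fin.Base using (Fin; toℕ)
open import Data.Fin.Permutation using (Permutation′; _⟨$⟩ˡ_)
open import Data.Fin.Properties using (_≟_; all?)
open import Data.Fin.Subset using (Subset; _∈_; _∉_; _⊆_; _∪_; ⊥; Nonempty)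
open import Data.Fin.Subset.Properties using (∉⊥; x∈p∪q⁻; x∈p∪q⁺; p⊆p∪q; q⊆p∪q)
open import Data.List.Base using (List; []; _∷_; length; filter)
open import Data.List.Membership.Propositional using () renaming (_∈_ to _∈ˡ_)
open import Data.List.Membership.Propositional.Properties using (∈-filter⁻)
open import Data.List.Relation.Unary.All as All using (All; []; _∷_)
import Data.List.Relation.Unary.All.Properties as All
open import Data.List.Relation.Unary.AllPairs using (AllPairs; []; _∷_)
import Data.List.Relation.Unary.AllPairs.Properties as AllPairs
open import Data.List.Relation.Unary.Any using (here; there)
open import Data.Nat.Base using (ℕ; suc; _+_; _*_; _∸_; _⊓_; _⊔_; _≤_; _≡ᵇ_; _<ᵇ_; ∣_-_∣)
open import Data.Nat.Properties using (∣-∣-comm)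
open import Data.Product.Base using (∃; ∃₂; _×_; _,_; proj₁; proj₂)
open import Data.Sum.Base using (inj₁; inj₂)
open import Data.Vec.Base using (lookup; tabulate)
open import Data.Vec.Properties using (≡-dec; lookup⇒[]=)
open import Function.Base using (_∘_)
open import Function.Bundles using (Equivalence)
open import Relation.Binary.PropositionalEquality using (_≡_; _≢_; refl; sym; cong)
open import Relation.Nullary using (¬_; ¬?; contradiction)
open import Relation.Nullary.Decidable using (⌊_⌋; from-yes; toWitnessFalse; fromWitnessFalse)

module 𝔽₂ = CommutativeRing xor-∧-commutativeRing
open import Algebra.Properties.Monoid.Sum 𝔽₂.+-monoid using (sum)

private variable
  n : ℕ

IsMinimum : (ℕ → Set) → ℕ → Set
IsMinimum P k = P k × (∀ j → P j → k ≤ j)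

IsMaximum : (ℕ → Set) → ℕ → Set
IsMaximum P k = P k × (∀ j → P j → j ≤ k)

record Graph (n : ℕ) : Set where
  field
    adj        : Fin n → Fin n → Bool
    adj-sym    : ∀ u v → adj u v ≡ adj v u
    adj-irrefl : ∀ v → adj v v ≡ false

  Adj : Fin n → Fin n → Set
  Adj u v = T (adj u v)

open Graph public

-- Matrices over 𝔽₂ = (Bool, xor, ∧), with rows indexed by A and columns
-- indexed by B.
Matrix : Set → Set → Set
Matrix A B = A → B → Bool

LinearlyIndependent : ∀ {B : Set} {r} → (Fin r → B → Bool) → Set
LinearlyIndependent {B} {r} w =
  ∀ (c : Fin r → Bool) →
  (∀ (b : B) → sum (λ i → c i 𝔽₂.* w i b) ≡ 𝔽₂.0#) →
  ∀ i → c i ≡ 𝔽₂.0#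

-- The rank is the largest length of a linearly independent family of rows.
Rank : ∀ {A B : Set} → Matrix A B → ℕ → Set
Rank {A} M = IsMaximum λ r → ∃ λ (row : Fin r → A) → LinearlyIndependent (M ∘ row)

cutMatrix : (G : Graph n) (X : Subset n) → Matrix (∃ (_∈ X)) (∃ (_∉ X))
cutMatrix G X (u , _) (v , _) = adj G u v

CutRank : Graph n → Subset n → ℕ → Set
CutRank G X = Rank (cutMatrix G X)

-- A linear order is a permutation π sending positions to vertices, so
-- π ⟨$⟩ˡ v is the (zero-based) position of the vertex v.
prefix : Permutation′ n → ℕ → Subset n
prefix π i = tabulate λ v → toℕ (π ⟨$⟩ˡ v) <ᵇ i

OrderWidth : Graph n → Permutation′ n → ℕ → Set
OrderWidth {n} G π =
  IsMaximum λ r → ∃ λ (i : Fin (suc n)) → CutRank G (prefix π (toℕ i)) r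

-- LinearRankWidth G k says that lrw(G) = k.
LinearRankWidth : Graph n → ℕ → Set
LinearRankWidth G = IsMinimum λ w → ∃ λ π → OrderWidth G π w

-- The family of live cables is a list whose order is immaterial. In every
-- configuration reachable by a play its members are nonempty and pairwise
-- disjoint (see reachable-wellFormed), so it has no repetitions and its
-- length is the number of live cables. The set of placed edges is a
-- symmetric Boolean relation.
record Configuration (n : ℕ) : Set where
  constructor ⟨_,_,_⟩
  field
    born   : Subset n
    live   : List (Subset n)
    placed : Fin n → Fin n → Bool

  Placed : Fin n → Fin n → Set
  Placed u v = T (placed u v)

open Configuration public

initial : Configuration n
initial = ⟨ ⊥ , [] , (λ _ _ → false) ⟩

data Move (n : ℕ) : Set where
  birth  : (S : Subset n) → Move n
  fold   : (X Y : Subset n) → Move n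
  block  : (X Y : Subset n) → Move n
  clique : (X : Subset n) → Move n
  close  : (X : Subset n) → Move n

remove : Subset n → List (Subset n) → List (Subset n)
remove X = filter λ Z → ¬? (≡-dec Bool._≟_ Z X)

placeBetween : Subset n → Subset n → (Fin n → Fin n → Bool) → Fin n → Fin n → Bool
placeBetween X Y E u v =
  E u v ∨ (lookup X u ∧ lookup Y v) ∨ (lookup Y u ∧ lookup X v)

placeInside : Subset n → (Fin n → Fin n → Bool) → Fin n → Fin n → Bool
placeInside X E u v = E u v ∨ (lookup X u ∧ lookup X v ∧ not ⌊ u ≟ v ⌋)

Legal : Graph n → Configuration n → Move n → Set
Legal G c (birth S) = Nonempty S × (∀ v → v ∈ S → v ∉ born c)
Legal G c (fold X Y) = X ∈ˡ live c × Y ∈ˡ live c × X ≢ Y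
Legal G c (block X Y) =
  X ∈ˡ live c × Y ∈ˡ live c × X ≢ Y ×
  (∀ u v → u ∈ X → v ∈ Y → Adj G u v) ×
  (∃₂ λ u v → u ∈ X × v ∈ Y × ¬ Placed c u v)
Legal G c (clique X) =
  X ∈ˡ live c ×
  (∀ u v → u ∈ X → v ∈ X → u ≢ v → Adj G u v) ×
  (∃₂ λ u v → u ∈ X × v ∈ X × Adj G u v × ¬ Placed c u v)
Legal G c (close X) =
  X ∈ˡ live c × (∀ u v → u ∈ X → Adj G u v → Placed c u v)

apply : Configuration n → Move n → Configuration n
apply ⟨ B , L , E ⟩ (birth S)   = ⟨ B ∪ S , S ∷ L , E ⟩
apply ⟨ B , L , E ⟩ (fold X Y)  = ⟨ B , (X ∪ Y) ∷ remove Y (remove X L) , E ⟩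
apply ⟨ B , L , E ⟩ (block X Y) = ⟨ B , L , placeBetween X Y E ⟩
apply ⟨ B , L , E ⟩ (clique X)  = ⟨ B , L , placeInside X E ⟩
apply ⟨ B , L , E ⟩ (close X)   = ⟨ B , remove X L , E ⟩

-- Legal fold and close moves require a live cable, so ∸ never truncates there.
cost : Configuration n → Move n → ℕ
cost c (birth S)   = 2 * length (live c) + 1
cost c (fold X Y)  = 2 * length (live c) ∸ 1
cost c (block X Y) = 2 * length (live c)
cost c (clique X)  = 2 * length (live c)
cost c (close X)   = 2 * length (live c) ∸ 1

data Play (G : Graph n) : Configuration n → Configuration n → Set where
  done : ∀ {c} → Play G c c
  move : ∀ {c d} (m : Move n) → Legal G c m → Play G (apply c m) d → Play G c d

width : ∀ {G : Graph n} {c d} → Play G c d → ℕ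
width done                 = 0
width (move {c = c} m _ p) = cost c m ⊔ width p

Constructs : ∀ {G : Graph n} {d} → Play G initial d → Set
Constructs {G = G} {d} _ =
  (∀ v → v ∈ born d) × (∀ u v → Adj G u v → Placed d u v) × live d ≡ []

-- SequentialCableWidth G k says that lsfw(G) = k.
SequentialCableWidth : Graph n → ℕ → Set
SequentialCableWidth G =
  IsMinimum λ w → ∃₂ λ d (p : Play G initial d) → Constructs p × width p ≡ w

cyclicDistance : Fin 7 → Fin 7 → ℕ
cyclicDistance u v = d ⊓ (7 ∸ d)
  where d = ∣ toℕ u - toℕ v ∣

H : Graph 7
H = record
  { adj        = λ u v → near (cyclicDistance u v)
  ; adj-sym    = λ u v → cong (λ d → near (d ⊓ (7 ∸ d))) (∣-∣-comm (toℕ u) (toℕ v))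
  ; adj-irrefl = from-yes (all? λ v → near (cyclicDistance v v) Bool.≟ false)
  }
  where
  near : ℕ → Bool
  near d = (d ≡ᵇ 2) ∨ (d ≡ᵇ 3)

-- H is the complement of the 7-cycle.
H-complement : ∀ u v → adj H u v ≡ not ⌊ u ≟ v ⌋ ∧ not (cyclicDistance u v ≡ᵇ 1)
H-complement = from-yes (all? λ u → all? λ v →
  adj H u v Bool.≟ (not ⌊ u ≟ v ⌋ ∧ not (cyclicDistance u v ≡ᵇ 1)))

Disjoint : Subset n → Subset n → Set
Disjoint X Y = ∀ v → v ∈ X → v ∉ Y

record WellFormed (G : Graph n) (c : Configuration n) : Set where
  field
    disjoint   : AllPairs Disjoint (live c)
    nonempty   : All Nonempty (live c)
    live⊆born  : All (_⊆ born c) (live c)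
    placed-sym : ∀ {u v} → Placed c u v → Placed c v u
    placed⊆adj : ∀ {u v} → Placed c u v → Adj G u v

private
  disjoint-sym : {X Y : Subset n} → Disjoint X Y → Disjoint Y X
  disjoint-sym d v v∈Y v∈X = d v v∈X v∈Y

  pairwise : ∀ {L : List (Subset n)} {X Y} → AllPairs Disjoint L →
             X ∈ˡ L → Y ∈ˡ L → X ≢ Y → Disjoint X Y
  pairwise (_ ∷ _)  (here refl) (here refl) X≢Y = contradiction refl X≢Y
  pairwise (d ∷ _)  (here refl) (there Y∈)  _   = All.lookup d Y∈
  pairwise (d ∷ _)  (there X∈)  (here refl) _   = disjoint-sym (All.lookup d X∈)
  pairwise (_ ∷ ds) (there X∈)  (there Y∈)  X≢Y = pairwise ds X∈ Y∈ X≢Y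

  ∈-remove : ∀ {L : List (Subset n)} {X Z} → Z ∈ˡ remove X L → Z ∈ˡ L × Z ≢ X
  ∈-remove {X = X} = ∈-filter⁻ (λ Z → ¬? (≡-dec Bool._≟_ Z X))

  All-remove : ∀ {P : Subset n → Set} {L} X → All P L → All P (remove X L)
  All-remove X = All.filter⁺ (λ Z → ¬? (≡-dec Bool._≟_ Z X))

  AllPairs-remove : ∀ {L : List (Subset n)} X → AllPairs Disjoint L →
                    AllPairs Disjoint (remove X L)
  AllPairs-remove X = AllPairs.filter⁺ (λ Z → ¬? (≡-dec Bool._≟_ Z X))

  T-lookup : ∀ (X : Subset n) v → T (lookup X v) → v ∈ X
  T-lookup X v t = lookup⇒[]= v X (Equivalence.to T-≡ t)

  ∨⁻ : ∀ {a b} {P : Set} → (T a → P) → (T b → P) → T (a ∨ b) → P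
  ∨⁻ f g t with Equivalence.to T-∨ t
  ... | inj₁ x = f x
  ... | inj₂ y = g y

  ∨ˡ : ∀ {a b} → T a → T (a ∨ b)
  ∨ˡ = Equivalence.from T-∨ ∘ inj₁

  ∨ʳ : ∀ {a b} → T b → T (a ∨ b)
  ∨ʳ = Equivalence.from T-∨ ∘ inj₂

  ∧⁻ : ∀ {a b} → T (a ∧ b) → T a × T b
  ∧⁻ = Equivalence.to T-∧

  ∧⁺ : ∀ {a b} → T a → T b → T (a ∧ b)
  ∧⁺ x y = Equivalence.from T-∧ (x , y)

  adj-flip : ∀ (G : Graph n) {u v} → Adj G u v → Adj G v u
  adj-flip G {u} {v} t rewrite adj-sym G u v = t

initial-wellFormed : ∀ (G : Graph n) → WellFormed G initial
initial-wellFormed G = record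
  { disjoint = [] ; nonempty = [] ; live⊆born = []
  ; placed-sym = λ () ; placed⊆adj = λ () }

apply-wellFormed : ∀ (G : Graph n) {c} m → Legal G c m →
                   WellFormed G c → WellFormed G (apply c m)
apply-wellFormed G {c} (birth S) (S≠∅ , fresh) wf = record
  { disjoint   = All.tabulate (λ Z∈ v v∈S v∈Z → fresh v v∈S (within Z∈ v∈Z)) ∷ disjoint
  ; nonempty   = S≠∅ ∷ nonempty
  ; live⊆born  = q⊆p∪q (born c) S ∷ All.tabulate (λ Z∈ v∈Z → p⊆p∪q S (within Z∈ v∈Z))
  ; placed-sym = placed-sym
  ; placed⊆adj = placed⊆adj
  }
  where
  open WellFormed wf
  within : ∀ {Z} → Z ∈ˡ live c → Z ⊆ born c
  within Z∈ = All.lookup {P = _⊆ born c} live⊆born Z∈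
apply-wellFormed G {c} (fold X Y) (X∈ , Y∈ , X≢Y) wf = record
  { disjoint   = All.tabulate separate ∷ AllPairs-remove Y (AllPairs-remove X disjoint)
  ; nonempty   = (proj₁ X≠∅ , x∈p∪q⁺ (inj₁ (proj₂ X≠∅))) ∷ All-remove Y (All-remove X nonempty)
  ; live⊆born  = union ∷ All-remove Y (All-remove X live⊆born)
  ; placed-sym = placed-sym
  ; placed⊆adj = placed⊆adj
  }
  where
  open WellFormed wf
  X≠∅ : Nonempty X
  X≠∅ = All.lookup nonempty X∈
  union : X ∪ Y ⊆ born c
  union v∈ with x∈p∪q⁻ X Y v∈
  ... | inj₁ v∈X = All.lookup {P = _⊆ born c} live⊆born X∈ v∈X
  ... | inj₂ v∈Y = All.lookup {P = _⊆ born c} live⊆born Y∈ v∈Y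
  separate : ∀ {Z} → Z ∈ˡ remove Y (remove X (live c)) → Disjoint (X ∪ Y) Z
  separate Z∈ v v∈ with ∈-remove Z∈
  ... | Z∈′ , Z≢Y with ∈-remove Z∈′
  ... | Z∈L , Z≢X with x∈p∪q⁻ X Y v∈
  ... | inj₁ v∈X = pairwise disjoint X∈ Z∈L (Z≢X ∘ sym) v v∈X
  ... | inj₂ v∈Y = pairwise disjoint Y∈ Z∈L (Z≢Y ∘ sym) v v∈Y
apply-wellFormed G {c} (block X Y) (_ , _ , _ , complete , _) wf = record
  { disjoint = disjoint ; nonempty = nonempty ; live⊆born = live⊆born
  ; placed-sym = λ {u} {v} → ∨⁻ (∨ˡ ∘ placed-sym)
      (∨⁻ (λ t → let x , y = ∧⁻ {lookup X u} t in
                 ∨ʳ {placed c v u} (∨ʳ {lookup X v ∧ lookup Y u} (∧⁺ y x)))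
          (λ t → let y , x = ∧⁻ {lookup Y u} t in
                 ∨ʳ {placed c v u} (∨ˡ (∧⁺ x y))))
  ; placed⊆adj = λ {u} {v} → ∨⁻ placed⊆adj
      (∨⁻ (λ t → let x , y = ∧⁻ {lookup X u} t in
                 complete u v (T-lookup X u x) (T-lookup Y v y))
          (λ t → let y , x = ∧⁻ {lookup Y u} t in
                 adj-flip G (complete v u (T-lookup X v x) (T-lookup Y u y))))
  } where open WellFormed wf
apply-wellFormed G {c} (clique X) (_ , complete , _) wf = record
  { disjoint = disjoint ; nonempty = nonempty ; live⊆born = live⊆born
  ; placed-sym = λ {u} {v} → ∨⁻ (∨ˡ ∘ placed-sym)
      (λ t → let x , y , u≢v = split u v t in
             ∨ʳ {placed c v u} (∧⁺ y (∧⁺ x (fromWitnessFalse (u≢v ∘ sym)))))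
  ; placed⊆adj = λ {u} {v} → ∨⁻ placed⊆adj
      (λ t → let x , y , u≢v = split u v t in
             complete u v (T-lookup X u x) (T-lookup X v y) u≢v)
  }
  where
  open WellFormed wf
  split : ∀ u v → T (lookup X u ∧ lookup X v ∧ not ⌊ u ≟ v ⌋) →
          T (lookup X u) × T (lookup X v) × u ≢ v
  split u v t with ∧⁻ {lookup X u} t
  ... | x , s with ∧⁻ {lookup X v} s
  ... | y , ne = x , y , toWitnessFalse ne
apply-wellFormed G {c} (close X) _ wf = record
  { disjoint   = AllPairs-remove X disjoint
  ; nonempty   = All-remove X nonempty
  ; live⊆born  = All-remove X live⊆born
  ; placed-sym = placed-sym
  ; placed⊆adj = placed⊆adj
  } where open WellFormed wf

reachable-wellFormed : ∀ {G : Graph n} {d} → Play G initial d → WellFormed G d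
reachable-wellFormed {G = G} = go (initial-wellFormed G)
  where
  go : ∀ {c d} → WellFormed G c → Play G c d → WellFormed G d
  go wf done         = wf
  go wf (move m l p) = go (apply-wellFormed G m l wf) p

{-# OPTIONS --safe #-}
-- In H any two distinct vertices are separated in both directions: each has a
-- neighbour which is neither the other vertex nor adjacent to it.
--
-- This makes every two-vertex cut have rank 2, so lrw(H) ≥ 2.
--
-- For lsfw(H) ≥ 8, call a configuration deadlocked if some live cable contains
-- u ≠ v while an edge uw with w ≠ v, w not adjacent to v, is not yet placed:
-- every block or clique placing uw would also need the non-edge vw, and the
-- cable cannot be closed, so a deadlock is permanent. While all cables are
-- singletons, joining two vertices in a cable avoids a deadlock only if the
-- placed edges already meet four vertices, and so does closing a cable. In
-- width at most 7 edges are placed with at most three live cables, so neither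
-- can happen.
module Submission where

open import Defs
open import Algebra.Properties.CommutativeMonoid.Sum 𝔽₂.+-commutativeMonoid
  using (sum; sum-cong-≗; sum-replicate-zero; ∑-distrib-+)
open import Data.Bool.Base using (Bool; true; false; _∧_; _xor_; T)
open import Data.Bool.Properties using (T?; T-∨; T-∧; T-≡; ∧-zeroʳ; ∧-identityʳ; xor-same)
import Data.Bool.Properties as Bool
open import Data.Fin.Base using (Fin; zero; suc; toℕ; fromℕ<)
open import Data.Fin.Patterns
open import Data.Fin.Permutation
  using (Permutation′; _⟨$⟩ʳ_; _⟨$⟩ˡ_; transpose; inverseˡ; inverseʳ)
open import Data.Fin.Properties using (_≟_; all?; any?; injective⇒≤; fromℕ<-injective; toℕ-injective)
open import Data.Fin.Subset using (Subset; _∈_; _∉_; _∪_; ⁅_⁆; Nonempty; ⊥)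
open import Data.Fin.Subset.Properties
  using (_∈?_; nonempty?; anySubset?; ∉⊥; x∈p∪q⁻; x∈p∪q⁺; x∈⁅x⁆; x∈⁅y⁆⇒x≡y; ⊆-antisym)
open import Data.List.Base as List using (List; []; _∷_; length; map; foldl)
open import Data.List.Membership.Propositional using () renaming (_∈_ to _∈ˡ_)
open import Data.List.Membership.Propositional.Properties using (∈-filter⁺; ∈-map⁺; ∈-map⁻; ∈-lookup)
open import Data.List.Membership.Setoid.Properties using (index-injective)
open import Data.List.Properties using (length-map)
import Data.List.Relation.Binary.Subset.Propositional as List
open import Data.List.Relation.Unary.All as All using (All; []; _∷_)
open import Data.List.Relation.Unary.AllPairs using (AllPairs; []; _∷_)
open import Data.List.Relation.Unary.Any as Any using (here; there)
open import Data.List.Relation.Unary.Unique.DecPropositional (_≟_ {7}) using (unique?)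
open import Data.List.Relation.Unary.Unique.Propositional using (Unique)
open import Data.Nat.Base using (ℕ; zero; suc; _+_; _*_; _∸_; _≤_; _<_; z≤n; s≤s; s≤s⁻¹)
open import Data.Nat.Properties
  using (≤-trans; ≤-refl; ≮⇒≥; <⇒≱; m⊔n≤o⇒m≤o; m⊔n≤o⇒n≤o; *-cancelˡ-<; <ᵇ⇒<; <⇒<ᵇ; m∸n+n≡m; _≤?_)
open import Data.Product.Base using (∃; _×_; _,_; proj₁; proj₂)
open import Data.Sum.Base as Sum using (_⊎_; inj₁; inj₂)
open import Data.Unit.Base using (⊤; tt)
open import Data.Vec.Base using (lookup)
open import Data.Vec.Properties using (≡-dec; lookup⇒[]=; []=⇒lookup; lookup∘tabulate)
open import Function.Base using (_∘_; id)
open import Function.Bundles using (Equivalence)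
open import Relation.Binary.PropositionalEquality
  using (_≡_; _≢_; refl; sym; trans; cong; cong₂; subst; setoid; module ≡-Reasoning)
open import Relation.Nullary using (Dec; yes; no; does; ¬_; ¬?; contradiction)
open import Relation.Nullary.Decidable
  using (_×-dec_; _→-dec_; from-yes; from-no; dec-true; dec-false)

private variable
  n : ℕ

-- Separating neighbours.

lookup⇒∈ : ∀ (X : Subset n) {v} → T (lookup X v) → v ∈ X
lookup⇒∈ X {v} = lookup⇒[]= v X ∘ Equivalence.to T-≡

adj⇒≢ : ∀ (G : Graph n) {u v} → Adj G u v → u ≢ v
adj⇒≢ G {u} a refl = subst T (adj-irrefl G u) a

-- Since `v` is never adjacent to itself, `v ≢ w` must be asked for separately. With adjacency to
-- `u` it keeps `w` outside the pair.
Separates : Graph n → Fin n → Fin n → Fin n → Set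
Separates G u v w = v ≢ w × Adj G u w × ¬ Adj G v w

-- abstract, so that later case splits do not unfold the exhaustive search
abstract
  separated : ∀ u v → u ≢ v → ∃ (Separates H u v)
  separated = from-yes (all? λ u → all? λ v → ¬? (u ≟ v) →-dec
    any? λ w → ¬? (v ≟ w) ×-dec T? (adj H u w) ×-dec ¬? (T? (adj H v w)))

-- Linear rank-width

single : ∀ {r} → Fin r → Fin r → Bool
single j k = does (k ≟ j)

sum-single : ∀ {r} (j : Fin r) (f : Fin r → Bool) → sum (λ k → single j k ∧ f k) ≡ f j
sum-single {suc r} zero f =
  trans (cong (f zero xor_) (sum-replicate-zero r)) (𝔽₂.+-identityʳ (f zero))
sum-single (suc j) f = sum-single j (f ∘ suc)

-- Over two elements, equal rows at `i ≢ j` cancel: the sum of the `i`-th and `j`-th unit vectors is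
-- a nonzero coefficient vector with vanishing combination.
independent-distinct : ∀ {B : Set} {r} {w : Fin r → B → Bool} → LinearlyIndependent w →
                       ∀ i j → (∀ b → w i b ≡ w j b) → i ≡ j
independent-distinct {w = w} indep i j same with i ≟ j
... | yes i≡j = i≡j
... | no  i≢j = contradiction (trans (sym true-at-i) (indep c vanishes i)) λ ()
  where
  c : _ → Bool
  c k = single i k xor single j k
  true-at-i : c i ≡ true
  true-at-i = cong₂ _xor_ (dec-true (i ≟ i) refl) (dec-false (i ≟ j) i≢j)
  open ≡-Reasoning
  vanishes : ∀ b → sum (λ k → c k ∧ w k b) ≡ false
  vanishes b = begin
    sum (λ k → c k ∧ w k b)
      ≡⟨ sum-cong-≗ (λ k → 𝔽₂.distribʳ (w k b) (single i k) (single j k)) ⟩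
    sum (λ k → (single i k ∧ w k b) xor (single j k ∧ w k b))
      ≡⟨ ∑-distrib-+ (λ k → single i k ∧ w k b) (λ k → single j k ∧ w k b) ⟩
    sum (λ k → single i k ∧ w k b) xor sum (λ k → single j k ∧ w k b)
      ≡⟨ cong₂ _xor_ (sum-single i (λ k → w k b)) (sum-single j (λ k → w k b)) ⟩
    w i b xor w j b
      ≡⟨ cong (_xor w j b) (same b) ⟩
    w j b xor w j b
      ≡⟨ xor-same (w j b) ⟩
    false ∎

independent-tail : ∀ {B : Set} {r} {w : Fin (suc r) → B → Bool} →
                   LinearlyIndependent w → LinearlyIndependent (w ∘ suc)
independent-tail indep c vanishes i = indep (λ { zero → false ; (suc k) → c k }) vanishes (suc i)

-- Reduces excluding every rank above two to a finite check on triples of rows.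
independent-smaller : ∀ {A B : Set} {M : Matrix A B} {k} m →
                      (∃ λ (row : Fin (m + k) → A) → LinearlyIndependent (M ∘ row)) →
                      ∃ λ (row : Fin k → A) → LinearlyIndependent (M ∘ row)
independent-smaller         zero    family        = family
independent-smaller {M = M} (suc m) (row , indep) =
  independent-smaller {M = M} m (row ∘ suc , independent-tail {w = M ∘ row} indep)

∈-prefix⁻ : ∀ (π : Permutation′ n) i {v} → v ∈ prefix π i → toℕ (π ⟨$⟩ˡ v) < i
∈-prefix⁻ π i {v} v∈ = <ᵇ⇒< _ i
  (Equivalence.from T-≡ (trans (sym (lookup∘tabulate _ v)) ([]=⇒lookup v∈)))

∈-prefix⁺ : ∀ (π : Permutation′ n) i k → toℕ k < i → π ⟨$⟩ʳ k ∈ prefix π i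
∈-prefix⁺ π i k k<i = lookup⇒[]= _ _ (trans (lookup∘tabulate _ (π ⟨$⟩ʳ k))
  (Equivalence.to T-≡ (<⇒<ᵇ (subst (λ l → toℕ l < i) (sym (inverseˡ π)) k<i))))

-- Independent rows belong to distinct vertices, so their positions inject into the `i` positions of
-- the prefix.
prefix-rank≤ : ∀ (G : Graph n) (π : Permutation′ n) i {r} →
               (∃ λ (row : Fin r → ∃ (_∈ prefix π i)) →
                  LinearlyIndependent (cutMatrix G (prefix π i) ∘ row)) → r ≤ i
prefix-rank≤ G π i (row , indep) = injective⇒≤ {f = position} λ {k} {l} eq →
  independent-distinct indep k l λ (v , _) → cong (λ u → adj G u v) (same-vertex eq)
  where
  bounded : ∀ k → toℕ (π ⟨$⟩ˡ proj₁ (row k)) < i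
  bounded k = ∈-prefix⁻ π i (proj₂ (row k))
  position : _ → Fin i
  position k = fromℕ< (bounded k)
  same-vertex : ∀ {k l} → position k ≡ position l → proj₁ (row k) ≡ proj₁ (row l)
  same-vertex {k} {l} eq = trans (sym (inverseʳ π)) (trans
    (cong (π ⟨$⟩ʳ_) (toℕ-injective (fromℕ<-injective _ _ (bounded k) (bounded l) eq)))
    (inverseʳ π))

∉-prefix₂ : ∀ (π : Permutation′ (2 + n)) {w} →
            π ⟨$⟩ʳ 0F ≢ w → π ⟨$⟩ʳ 1F ≢ w → w ∉ prefix π 2
∉-prefix₂ π {w} ≢₀ ≢₁ w∈ with π ⟨$⟩ˡ w in eq | ∈-prefix⁻ π 2 w∈
... | 0F          | _             = ≢₀ (trans (cong (π ⟨$⟩ʳ_) (sym eq)) (inverseʳ π))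
... | 1F          | _             = ≢₁ (trans (cong (π ⟨$⟩ʳ_) (sym eq)) (inverseʳ π))
... | suc (suc _) | s≤s (s≤s ())

¬T⇒≡false : ∀ {b} → ¬ T b → b ≡ false
¬T⇒≡false {false} _  = refl
¬T⇒≡false {true}  ¬t = contradiction tt ¬t

-- The separating neighbour of each of the two vertices is a column outside the prefix with a one in
-- its row and a zero in the other, which forces each coefficient to vanish.
prefix₂-rank : ∀ π → CutRank H (prefix π 2) 2
prefix₂-rank π = (row , indep) , λ _ → prefix-rank≤ H π 2
  where
  u v : Fin 7
  u = π ⟨$⟩ʳ 0F
  v = π ⟨$⟩ʳ 1F
  u≢v : u ≢ v
  u≢v eq with trans (sym (inverseˡ π)) (trans (cong (π ⟨$⟩ˡ_) eq) (inverseˡ π))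
  ... | ()
  row : Fin 2 → ∃ (_∈ prefix π 2)
  row 0F = u , ∈-prefix⁺ π 2 0F (s≤s z≤n)
  row 1F = v , ∈-prefix⁺ π 2 1F (s≤s (s≤s z≤n))
  indep : LinearlyIndependent (cutMatrix H (prefix π 2) ∘ row)
  indep c vanishes 0F with separated u v u≢v
  ... | w , v≢w , uw , ¬vw with vanishes (w , ∉-prefix₂ π (adj⇒≢ H uw) v≢w)
  ... | eq rewrite Equivalence.to T-≡ uw | ¬T⇒≡false ¬vw
                 | ∧-zeroʳ (c 1F) | ∧-identityʳ (c 0F) | 𝔽₂.+-identityʳ (c 0F) = eq
  indep c vanishes 1F with separated v u (u≢v ∘ sym)
  ... | w , u≢w , vw , ¬uw with vanishes (w , ∉-prefix₂ π u≢w (adj⇒≢ H vw))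
  ... | eq rewrite Equivalence.to T-≡ vw | ¬T⇒≡false ¬uw
                 | ∧-zeroʳ (c 0F) | ∧-identityʳ (c 1F) | 𝔽₂.+-identityʳ (c 1F) = eq

-- The order 0, 1, 4, 3, 2, 5, 6. The natural order fails, as the cut at {0,1,2} has rank three;
-- with 4 in third place the rows of 0, 1 and 4 sum to zero.
order : Permutation′ 7
order = transpose 2F 4F

abstract
  -- A decidable form of rank at most two: `C` is the support of a vanishing combination. Repeated
  -- vertices among `x`, `y`, `z` are allowed, as equal rows cancel.
  three-rows-dependent : ∀ (i : Fin 8) x y z → let P = prefix order (toℕ i) in
    x ∈ P → y ∈ P → z ∈ P → ∃ λ (C : Subset 3) → Nonempty C ×
    (∀ b → b ∉ P → sum (λ k → lookup C k ∧ adj H (List.lookup (x ∷ y ∷ z ∷ []) k) b) ≡ false)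
  three-rows-dependent = from-yes (all? {n = 8} λ i → let P = prefix order (toℕ i) in
    all? λ x → all? λ y → all? λ z → (x ∈? P) →-dec (y ∈? P) →-dec (z ∈? P) →-dec
    anySubset? λ C → nonempty? C ×-dec all? λ b → ¬? (b ∈? P) →-dec
    (sum (λ k → lookup C k ∧ adj H (List.lookup (x ∷ y ∷ z ∷ []) k) b) Bool.≟ false))

order-width : OrderWidth H order 2
order-width = (2F , prefix₂-rank order) , λ r (i , family , _) → ≮⇒≥ λ 2<r → bounded i r 2<r family
  where
  bounded : ∀ i r → 2 < r → ¬ ∃ λ (row : Fin r → ∃ (_∈ prefix order (toℕ i))) →
            LinearlyIndependent (cutMatrix H (prefix order (toℕ i)) ∘ row)
  bounded i r 2<r family
    with row , indep ← independent-smaller {M = cutMatrix H (prefix order (toℕ i))} {k = 3} (r ∸ 3)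
           (subst (λ s → ∃ λ (row : Fin s → _) → LinearlyIndependent (cutMatrix H _ ∘ row))
             (sym (m∸n+n≡m 2<r)) family)
    with C , (k , k∈C) , vanishes ← three-rows-dependent i _ _ _
           (proj₂ (row 0F)) (proj₂ (row 1F)) (proj₂ (row 2F))
    = contradiction (trans (sym ([]=⇒lookup k∈C)) (indep (lookup C) (λ (b , b∉) → vanishes b b∉) k)) λ ()

linear-rank-width : LinearRankWidth H 2
linear-rank-width =
  (order , order-width) , λ _ (π , _ , maximal) → maximal 2 (2F , prefix₂-rank π)

-- Deadlocks

record Deadlocked (G : Graph n) (c : Configuration n) : Set where
  constructor deadlock
  field
    {cable}  : Subset n
    {u v w}  : Fin n
    cable∈   : cable ∈ˡ live c
    u∈       : u ∈ cable
    v∈       : v ∈ cable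
    separate : Separates G u v w
    unplaced : ¬ Placed c u w

placed-block⁻ : ∀ (c : Configuration n) X Y {u v} → Placed (apply c (block X Y)) u v →
                Placed c u v ⊎ (u ∈ X × v ∈ Y) ⊎ (u ∈ Y × v ∈ X)
placed-block⁻ c X Y = Sum.map₂ (Sum.map (both X Y) (both Y X) ∘ Equivalence.to T-∨)
                      ∘ Equivalence.to T-∨
  where
  both : ∀ Z W {u v} → T (lookup Z u ∧ lookup W v) → u ∈ Z × v ∈ W
  both Z W t with z , w ← Equivalence.to T-∧ t = lookup⇒∈ Z z , lookup⇒∈ W w

placed-clique⁻ : ∀ (c : Configuration n) X {u v} → Placed (apply c (clique X)) u v →
                 Placed c u v ⊎ (u ∈ X × v ∈ X)
placed-clique⁻ c X {u} {v} = Sum.map₂ both ∘ Equivalence.to T-∨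
  where
  both : T (lookup X u ∧ lookup X v ∧ _) → u ∈ X × v ∈ X
  both t with x , s ← Equivalence.to (T-∧ {lookup X u}) t =
    lookup⇒∈ X x , lookup⇒∈ X (proj₁ (Equivalence.to (T-∧ {lookup X v}) s))

shared⇒same : ∀ {L : List (Subset n)} {X Y v} → AllPairs Disjoint L →
              X ∈ˡ L → Y ∈ˡ L → v ∈ X → v ∈ Y → X ≡ Y
shared⇒same _        (here refl) (here refl) _   _   = refl
shared⇒same (d ∷ _)  (here refl) (there Y∈)  v∈X v∈Y = contradiction v∈Y (All.lookup d Y∈ _ v∈X)
shared⇒same (d ∷ _)  (there X∈)  (here refl) v∈X v∈Y = contradiction v∈X (All.lookup d X∈ _ v∈Y)
shared⇒same (_ ∷ ds) (there X∈)  (there Y∈)  v∈X v∈Y = shared⇒same ds X∈ Y∈ v∈X v∈Y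

∈-remove⁺ : ∀ {L : List (Subset n)} {X Z} → Z ∈ˡ L → Z ≢ X → Z ∈ˡ remove X L
∈-remove⁺ {X = X} = ∈-filter⁺ (λ Z → ¬? (≡-dec Bool._≟_ Z X))

apply-deadlocked : ∀ (G : Graph n) {c} m → Legal G c m → WellFormed G c →
                   Deadlocked G c → Deadlocked G (apply c m)
apply-deadlocked G (birth S) _ _ (deadlock Z∈ u∈ v∈ sep ¬uw) =
  deadlock (there Z∈) u∈ v∈ sep ¬uw
apply-deadlocked G (fold X Y) _ _ (deadlock {cable = Z} Z∈ u∈ v∈ sep ¬uw)
  with ≡-dec Bool._≟_ Z X | ≡-dec Bool._≟_ Z Y
... | yes refl | _        =
  deadlock (here refl) (x∈p∪q⁺ (inj₁ u∈)) (x∈p∪q⁺ (inj₁ v∈)) sep ¬uw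
... | no _     | yes refl =
  deadlock (here refl) (x∈p∪q⁺ (inj₂ u∈)) (x∈p∪q⁺ (inj₂ v∈)) sep ¬uw
... | no Z≢X   | no Z≢Y   =
  deadlock (there (∈-remove⁺ (∈-remove⁺ Z∈ Z≢X) Z≢Y)) u∈ v∈ sep ¬uw
apply-deadlocked G {c} (block X Y) (X∈ , Y∈ , _ , complete , _) wf
    (deadlock {u = u} {v} {w} Z∈ u∈ v∈ sep@(_ , _ , ¬vw) ¬uw) =
  deadlock Z∈ u∈ v∈ sep (still ∘ placed-block⁻ c X Y)
  where
  open WellFormed wf
  still : ¬ (Placed c u w ⊎ (u ∈ X × w ∈ Y) ⊎ (u ∈ Y × w ∈ X))
  still (inj₁ uw) = ¬uw uw
  -- Live cables are disjoint, so the blocked cable containing `u` is the deadlocked one, and the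
  -- block would also place the non-edge `vw`.
  still (inj₂ (inj₁ (u∈X , w∈Y))) with refl ← shared⇒same disjoint X∈ Z∈ u∈X u∈ =
    ¬vw (complete v w v∈ w∈Y)
  still (inj₂ (inj₂ (u∈Y , w∈X))) with refl ← shared⇒same disjoint Y∈ Z∈ u∈Y u∈ =
    ¬vw (subst T (adj-sym G w v) (complete w v w∈X v∈))
apply-deadlocked G {c} (clique X) (X∈ , complete , _) wf
    (deadlock {u = u} {v} {w} Z∈ u∈ v∈ sep@(v≢w , _ , ¬vw) ¬uw) =
  deadlock Z∈ u∈ v∈ sep (still ∘ placed-clique⁻ c X)
  where
  open WellFormed wf
  still : ¬ (Placed c u w ⊎ (u ∈ X × w ∈ X))
  still (inj₁ uw) = ¬uw uw
  -- Here `w` lies in the deadlocked cable too; `v≢w` is what makes the clique condition demand the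
  -- edge `vw`.
  still (inj₂ (u∈X , w∈X)) with refl ← shared⇒same disjoint X∈ Z∈ u∈X u∈ =
    ¬vw (complete v w v∈ w∈X v≢w)
apply-deadlocked G (close X) (_ , finished) _
    (deadlock {u = u} {w = w} Z∈ u∈ v∈ sep@(_ , uw , _) ¬uw) =
  deadlock (∈-remove⁺ Z∈ λ { refl → ¬uw (finished u w u∈ uw) }) u∈ v∈ sep ¬uw

deadlocked-endless : ∀ {G : Graph n} {c d} → WellFormed G c → Deadlocked G c →
                     Play G c d → live d ≢ []
deadlocked-endless _  (deadlock Z∈ _ _ _ _) done refl with () ← Z∈
deadlocked-endless {G = G} wf dl (move m legal p) =
  deadlocked-endless (apply-wellFormed G m legal wf) (apply-deadlocked G m legal wf dl) p

-- Plays of width at most seven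

lookup-injective : ∀ {A : Set} {xs : List A} → Unique xs → ∀ {i j} →
                   List.lookup xs i ≡ List.lookup xs j → i ≡ j
lookup-injective (_ ∷ _)  {zero}  {zero}  _  = refl
lookup-injective (d ∷ _)  {zero}  {suc j} eq = contradiction eq (All.lookup d (∈-lookup j))
lookup-injective (d ∷ _)  {suc i} {zero}  eq = contradiction (sym eq) (All.lookup d (∈-lookup i))
lookup-injective (_ ∷ ds) {suc i} {suc j} eq = cong suc (lookup-injective ds eq)

-- Pigeonhole: sending each index of `xs` to a position of the same entry in `ys` is injective.
unique-⊆⇒length≤ : ∀ {A : Set} {xs ys : List A} → Unique xs → xs List.⊆ ys → length xs ≤ length ys
unique-⊆⇒length≤ {A} unique xs⊆ys = injective⇒≤ λ {i} {j} eq → lookup-injective unique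
  (index-injective (setoid A) (xs⊆ys (∈-lookup i)) (xs⊆ys (∈-lookup j)) eq)

-- The invariant of a play that is not deadlocked: every born vertex is still live, alone in its
-- cable. `ends` contains all endpoints of placed edges and is kept apart from `singles`, because a
-- birth at three live cables costs only seven and makes a fourth singleton.
record Sparse (c : Configuration n) : Set where
  field
    singles  : List (Fin n)
    ends     : List (Fin n)
    live≡    : live c ≡ map ⁅_⁆ singles
    born⊆    : ∀ {v} → v ∈ born c → v ∈ˡ singles
    ends⊆    : ends List.⊆ singles
    ends≤3   : length ends ≤ 3
    placed⊆  : ∀ {u v} → Placed c u v → u ∈ˡ ends × v ∈ˡ ends

initial-sparse : Sparse {n} initial
initial-sparse = record
  { singles = [] ; ends = [] ; live≡ = refl ; born⊆ = λ v∈ → contradiction v∈ ∉⊥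
  ; ends⊆ = id ; ends≤3 = z≤n ; placed⊆ = λ () }

no-four-ends : ∀ {ends zs : List (Fin 7)} → length ends ≤ 3 → 4 ≤ length zs → Unique zs →
               ¬ All (_∈ˡ ends) zs
no-four-ends ends≤3 4≤zs unique zs⊆ =
  <⇒≱ (≤-trans (s≤s ends≤3) 4≤zs) (unique-⊆⇒length≤ unique (All.lookup zs⊆))

-- Take separating neighbours `x` of `u` and `y` of `v`. Unless `ux` or `vy` is unplaced, the four
-- vertices `u`, `v`, `x`, `y` are all in `ends`; they are distinct, `x` and `y` because only `y` is
-- adjacent to `v`.
joined⇒deadlocked : ∀ {c X u v} {ends : List (Fin 7)} → length ends ≤ 3 →
                    (∀ {u v} → Placed c u v → u ∈ˡ ends × v ∈ˡ ends) →
                    X ∈ˡ live c → u ∈ X → v ∈ X → u ≢ v → Deadlocked H c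
joined⇒deadlocked {c} {u = u} {v} ends≤3 placed⊆ X∈ u∈ v∈ u≢v
  with separated u v u≢v | separated v u (u≢v ∘ sym)
... | x , sx@(v≢x , ux , ¬vx) | y , sy@(u≢y , vy , ¬uy)
  with T? (placed c u x) | T? (placed c v y)
... | no ¬placed | _          = deadlock X∈ u∈ v∈ sx ¬placed
... | yes _      | no ¬placed = deadlock X∈ v∈ u∈ sy ¬placed
... | yes placed₁ | yes placed₂ with placed⊆ placed₁ | placed⊆ placed₂
... | u∈ends , x∈ends | v∈ends , y∈ends = contradiction
  (u∈ends ∷ v∈ends ∷ x∈ends ∷ y∈ends ∷ [])
  (no-four-ends ends≤3 ≤-refl
    ((u≢v ∷ adj⇒≢ H ux ∷ u≢y ∷ []) ∷ (v≢x ∷ adj⇒≢ H vy ∷ []) ∷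
     ((λ { refl → ¬vx vy }) ∷ []) ∷ [] ∷ []))

abstract
  -- Closing a singleton needs all its edges placed, and three neighbours already give four ends.
  three-neighbours : ∀ u → ∃ λ x → ∃ λ y → ∃ λ z →
    Adj H u x × Adj H u y × Adj H u z × Unique (u ∷ x ∷ y ∷ z ∷ [])
  three-neighbours = from-yes (all? λ u → any? λ x → any? λ y → any? λ z →
    T? (adj H u x) ×-dec T? (adj H u y) ×-dec T? (adj H u z) ×-dec unique? (u ∷ x ∷ y ∷ z ∷ []))

module _ {c : Configuration 7} (sparse : Sparse c) where
  open Sparse sparse

  live⇒singleton : ∀ {X} → X ∈ˡ live c → ∃ λ x → x ∈ˡ singles × X ≡ ⁅ x ⁆
  live⇒singleton X∈ = ∈-map⁻ ⁅_⁆ (subst (_ ∈ˡ_) live≡ X∈)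

  ∈-live⇒∈-singles : ∀ {X v} → X ∈ˡ live c → v ∈ X → v ∈ˡ singles
  ∈-live⇒∈-singles X∈ v∈ with x , x∈ , refl ← live⇒singleton X∈ =
    subst (_∈ˡ singles) (sym (x∈⁅y⁆⇒x≡y x v∈)) x∈

  -- Serves block and clique alike: the cost bound leaves at most three live singletons, so `ends`
  -- can be reset to all of `singles`.
  placing-sparse : 2 * length (live c) ≤ 7 → ∀ E →
                   (∀ {u v} → T (E u v) → Placed c u v ⊎ u ∈ˡ singles × v ∈ˡ singles) →
                   Sparse ⟨ born c , live c , E ⟩
  placing-sparse cost≤7 E new = record
    { singles = singles ; ends = singles ; live≡ = live≡ ; born⊆ = born⊆ ; ends⊆ = id
    -- From cost at most 7, twice the number of live cables is below 2 * 4.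
    ; ends≤3  = subst (_≤ 3) (trans (cong length live≡) (length-map ⁅_⁆ singles))
                  (s≤s⁻¹ (*-cancelˡ-< 2 _ 4 (s≤s cost≤7)))
    ; placed⊆ = λ t → case-new (new t)
    }
    where
    case-new : ∀ {u v} → Placed c u v ⊎ u ∈ˡ singles × v ∈ˡ singles → u ∈ˡ singles × v ∈ˡ singles
    case-new (inj₁ uv) with u∈ , v∈ ← placed⊆ uv = ends⊆ u∈ , ends⊆ v∈
    case-new (inj₂ uv) = uv

  -- Births and folds place no edge, so the bound on `ends` survives them and any cable they make
  -- with two vertices is deadlocked. Closing is impossible.
  apply-sparse : ∀ m → Legal H c m → cost c m ≤ 7 →
                 Deadlocked H (apply c m) ⊎ Sparse (apply c m)
  apply-sparse (birth S) ((s , s∈) , _) _ with any? (λ v → v ∈? S ×-dec ¬? (s ≟ v))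
  ... | yes (v , v∈ , s≢v) = inj₁ (joined⇒deadlocked ends≤3 placed⊆ (here refl) s∈ v∈ s≢v)
  ... | no  lone           = inj₂ record
    { singles = s ∷ singles ; ends = ends ; live≡ = cong₂ _∷_ S≡ live≡
    ; born⊆ = λ v∈ → newborn (x∈p∪q⁻ (born c) S v∈)
    ; ends⊆ = there ∘ ends⊆ ; ends≤3 = ends≤3 ; placed⊆ = placed⊆ }
    where
    only-s : ∀ {v} → v ∈ S → v ≡ s
    only-s {v} v∈ with s ≟ v
    ... | yes s≡v = sym s≡v
    ... | no  s≢v = contradiction (v , v∈ , s≢v) lone
    S≡ : S ≡ ⁅ s ⁆
    S≡ = ⊆-antisym (λ v∈ → subst (_∈ ⁅ s ⁆) (sym (only-s v∈)) (x∈⁅x⁆ s))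
                   (λ v∈ → subst (_∈ S) (sym (x∈⁅y⁆⇒x≡y s v∈)) s∈)
    newborn : ∀ {v} → v ∈ born c ⊎ v ∈ S → v ∈ˡ s ∷ singles
    newborn (inj₁ v∈) = there (born⊆ v∈)
    newborn (inj₂ v∈) = here (only-s v∈)
  apply-sparse (fold X Y) (X∈ , Y∈ , X≢Y) _ with live⇒singleton X∈ | live⇒singleton Y∈
  ... | x , _ , refl | y , _ , refl = inj₁ (joined⇒deadlocked ends≤3 placed⊆ (here refl)
    (x∈p∪q⁺ (inj₁ (x∈⁅x⁆ x))) (x∈p∪q⁺ (inj₂ (x∈⁅x⁆ y))) (X≢Y ∘ cong ⁅_⁆))
  apply-sparse (block X Y) (X∈ , Y∈ , _) cost≤7 = inj₂ (placing-sparse cost≤7 _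
    (Sum.map₂ Sum.[ (λ (u∈ , v∈) → ∈-live⇒∈-singles X∈ u∈ , ∈-live⇒∈-singles Y∈ v∈)
                  , (λ (u∈ , v∈) → ∈-live⇒∈-singles Y∈ u∈ , ∈-live⇒∈-singles X∈ v∈) ]
     ∘ placed-block⁻ c X Y))
  apply-sparse (clique X) (X∈ , _) cost≤7 = inj₂ (placing-sparse cost≤7 _
    (Sum.map₂ (λ (u∈ , v∈) → ∈-live⇒∈-singles X∈ u∈ , ∈-live⇒∈-singles X∈ v∈)
     ∘ placed-clique⁻ c X))
  apply-sparse (close X) (X∈ , finished) _
    with u , _ , refl ← live⇒singleton X∈
    with x , y , z , ux , uy , uz , unique ← three-neighbours u =
    contradiction (proj₁ (meets ux) ∷ proj₂ (meets ux) ∷ proj₂ (meets uy) ∷ proj₂ (meets uz) ∷ [])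
                  (no-four-ends ends≤3 ≤-refl unique)
    where
    meets : ∀ {v} → Adj H u v → u ∈ˡ ends × v ∈ˡ ends
    meets uv = placed⊆ (finished u _ (x∈⁅x⁆ u) uv)

sparse-unfinished : ∀ {c d} → WellFormed H c → Sparse c → (p : Play H c d) → width p ≤ 7 →
                    (∀ v → v ∈ born d) → live d ≢ []
-- Vertex 0 is born, hence still live as a singleton, so the final family of cables is not empty.
sparse-unfinished _ sparse done _ all-born empty
  with () ← subst (_ ∈ˡ_) (trans (sym (Sparse.live≡ sparse)) empty)
              (∈-map⁺ ⁅_⁆ (Sparse.born⊆ sparse (all-born 0F)))
sparse-unfinished wf sparse (move {c = c} m legal p) width≤7 all-born
  with apply-sparse sparse m legal (m⊔n≤o⇒m≤o (cost c m) (width p) width≤7)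
... | inj₁ dl      = deadlocked-endless (apply-wellFormed H m legal wf) dl p
... | inj₂ sparse′ = sparse-unfinished (apply-wellFormed H m legal wf) sparse′ p
                       (m⊔n≤o⇒n≤o (cost c m) (width p) width≤7) all-born

-- A play of width eight

_∈ˡ?_ : (X : Subset n) (L : List (Subset n)) → Dec (X ∈ˡ L)
X ∈ˡ? L = Any.any? (≡-dec Bool._≟_ X) L

legal? : ∀ (G : Graph n) c m → Dec (Legal G c m)
legal? G c (birth S) =
  nonempty? S ×-dec all? λ v → v ∈? S →-dec ¬? (v ∈? born c)
legal? G c (fold X Y) =
  (X ∈ˡ? live c) ×-dec (Y ∈ˡ? live c) ×-dec ¬? (≡-dec Bool._≟_ X Y)
legal? G c (block X Y) =
  (X ∈ˡ? live c) ×-dec (Y ∈ˡ? live c) ×-dec ¬? (≡-dec Bool._≟_ X Y) ×-dec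
  (all? λ u → all? λ v → u ∈? X →-dec v ∈? Y →-dec T? (adj G u v)) ×-dec
  (any? λ u → any? λ v → u ∈? X ×-dec v ∈? Y ×-dec ¬? (T? (placed c u v)))
legal? G c (clique X) =
  (X ∈ˡ? live c) ×-dec
  (all? λ u → all? λ v → u ∈? X →-dec v ∈? X →-dec ¬? (u ≟ v) →-dec T? (adj G u v)) ×-dec
  (any? λ u → any? λ v →
    u ∈? X ×-dec v ∈? X ×-dec T? (adj G u v) ×-dec ¬? (T? (placed c u v)))
legal? G c (close X) =
  (X ∈ˡ? live c) ×-dec
  (all? λ u → all? λ v → u ∈? X →-dec T? (adj G u v) →-dec T? (placed c u v))

AllLegal : Graph n → Configuration n → List (Move n) → Set
AllLegal G c []       = ⊤
AllLegal G c (m ∷ ms) = Legal G c m × AllLegal G (apply c m) ms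

allLegal? : ∀ (G : Graph n) c ms → Dec (AllLegal G c ms)
allLegal? G c []       = yes tt
allLegal? G c (m ∷ ms) = legal? G c m ×-dec allLegal? G (apply c m) ms

play : ∀ {G : Graph n} {c} ms → AllLegal G c ms → Play G c (foldl apply c ms)
play []       _           = done
play (m ∷ ms) (l , legal) = move m l (play ms legal)

⟦_⟧ : List (Fin 7) → Subset 7
⟦_⟧ = List.foldr (λ v → ⁅ v ⁆ ∪_) ⊥

-- When vertex k+1 is born (k from 2 to 5), the live cables are {0}, {1,...,k-1} and {k}. The middle
-- one lies wholly in the neighbourhood of k+1, while k is not adjacent to k+1 and is folded in only
-- afterwards. Vertex 0 stays apart because it misses 6. Blocks with four live cables cost eight,
-- the maximum.
moves : List (Move 7)
moves =
  birth ⟦ 0F ∷ [] ⟧ ∷ birth ⟦ 1F ∷ [] ⟧ ∷ birth ⟦ 2F ∷ [] ⟧ ∷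
  block ⟦ 0F ∷ [] ⟧ ⟦ 2F ∷ [] ⟧ ∷
  birth ⟦ 3F ∷ [] ⟧ ∷
  block ⟦ 1F ∷ [] ⟧ ⟦ 3F ∷ [] ⟧ ∷
  block ⟦ 0F ∷ [] ⟧ ⟦ 3F ∷ [] ⟧ ∷
  fold ⟦ 1F ∷ [] ⟧ ⟦ 2F ∷ [] ⟧ ∷
  birth ⟦ 4F ∷ [] ⟧ ∷
  block ⟦ 1F ∷ 2F ∷ [] ⟧ ⟦ 4F ∷ [] ⟧ ∷
  block ⟦ 0F ∷ [] ⟧ ⟦ 4F ∷ [] ⟧ ∷
  fold ⟦ 1F ∷ 2F ∷ [] ⟧ ⟦ 3F ∷ [] ⟧ ∷
  birth ⟦ 5F ∷ [] ⟧ ∷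
  block ⟦ 1F ∷ 2F ∷ 3F ∷ [] ⟧ ⟦ 5F ∷ [] ⟧ ∷
  block ⟦ 0F ∷ [] ⟧ ⟦ 5F ∷ [] ⟧ ∷
  fold ⟦ 1F ∷ 2F ∷ 3F ∷ [] ⟧ ⟦ 4F ∷ [] ⟧ ∷
  birth ⟦ 6F ∷ [] ⟧ ∷
  block ⟦ 1F ∷ 2F ∷ 3F ∷ 4F ∷ [] ⟧ ⟦ 6F ∷ [] ⟧ ∷
  close ⟦ 6F ∷ [] ⟧ ∷ close ⟦ 5F ∷ [] ⟧ ∷
  close ⟦ 1F ∷ 2F ∷ 3F ∷ 4F ∷ [] ⟧ ∷ close ⟦ 0F ∷ [] ⟧ ∷ []

final : Configuration 7
final = foldl apply initial moves

abstract
  all-legal : AllLegal H initial moves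
  all-legal = from-yes (allLegal? H initial moves)

abstract
  all-born : ∀ v → v ∈ born final
  all-born = from-yes (all? λ v → v ∈? born final)

abstract
  all-placed : ∀ u v → Adj H u v → Placed final u v
  all-placed = from-yes (all? λ u → all? λ v → T? (adj H u v) →-dec T? (placed final u v))

sequential-cable-width : SequentialCableWidth H 8
sequential-cable-width =
  (final , play moves all-legal ,
    (all-born , all-placed , refl) , refl) ,
  λ { _ (_ , p , (born , _ , closed) , refl) → ≮⇒≥ λ { (s≤s width≤7) →
    sparse-unfinished (initial-wellFormed H) initial-sparse p width≤7 born closed } }

theorem5p7 : LinearRankWidth H 2
    × SequentialCableWidth H 8
    × ¬ (∀ (n : ℕ) (G : Graph n) (a b : ℕ) →
    SequentialCableWidth G a → LinearRankWidth G b → a ≤ 2 * b + 2)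
theorem5p7 = linear-rank-width , sequential-cable-width ,
  λ bound → from-no (8 ≤? 6) (bound 7 H 8 2 sequential-cable-width linear-rank-width)
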